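{- Let $s\geq 5$ be an integer congruent to $3$ or $5$ modulo $6$, let $S$ be a Steiner triple system on $[s-2]$, and let $n\in\mathbb{N}$. Let $G_S$ be the 3-graph on $[n]$ built from $S$ and a balanced partition $[n]=\bigsqcup_{i=1}^{s-2}V_i$ as described in the context. Then $G_S$ is $K_s$-free and has minimum codegree \[\delta_2(G_S)=\left(1-\frac{1}{s-2}\right)n+O(1),\] where $s$ is fixed, $n\to\infty$, and the implied constant depends only on $s$.
   Context: A 3-graph is a pair $G=(V,E)$ with $V$ a finite vertex set and $E$ a set of 3-element subsets of $V$ (the 3-edges). The codegree $d(x,y)$ of two distinct vertices is the number of 3-edges containing both, and $\delta_2(G)$ is the minimum of $d(x,y)$ over all pairs of distinct vertices. $K_s$ denotes the complete 3-graph on $s$ vertices; $G$ is $K_s$-free if no $s$ vertices of $G$ have all their triples in $E$. Write $[m]=\{1,\dots,m\}$. A Steiner triple system on $[m]$ is a 3-graph on vertex set $[m]$ in which every pair of distinct vertices is contained in exactly one 3-edge. Construction of $G_S$: given a Steiner triple system $S$ on $[s-2]$ and $n\in\mathbb{N}$, let $[n]=\bigsqcup_{i=1}^{s-2}V_i$ be a balanced partition (part sizes differ by at most $1$). The 3-graph $G_S$ has vertex set $[n]$, and its 3-edges are exactly: (i) all triples with two vertices in $V_i$ and one vertex in $V_j$, for distinct $i,j\in[s-2]$; (ii) all triples with one vertex in each of $V_i,V_j,V_k$, for distinct $i,j,k\in[s-2]$ such that $ijk$ is not a 3-edge of $S$. -}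

module Defs where

open import Data.Fin.Base using (Fin)
open import Data.Fin.Properties using (_≟_; any?)
open import Data.Fin.Subset
  using (Subset; inside; outside; _∈_; _⊆_; _∩_; _∪_; ⁅_⁆; ∣_∣)
open import Data.Fin.Subset.Properties using (_∈?_)
open import Data.List.Base
  using (List; [_]; _++_; map; filter; length; allFin; cartesianProduct)
open import Data.List.Extrema.Nat using (min)
open import Data.Nat.Base using (ℕ; zero; suc; _≤_; _∸_; NonZero; >-nonZero; z≤n; s≤s)
open import Data.Nat.Properties as ℕ using (∸-monoˡ-≤; ≤-trans)
open import Data.Product using (_×_; _,_; ∃-syntax; ∃!; uncurry; proj₁)
open import Data.Sum.Base using (_⊎_)
import Data.Vec.Base as Vec
open import Level using (0ℓ)
open import Relation.Binary.PropositionalEquality using (_≡_; _≢_)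
open import Relation.Nullary using (¬_; ¬?; _×-dec_; _⊎-dec_)
open import Relation.Unary using (Pred; Decidable)

private
  variable
    m n : ℕ

-- 3-graphs on the vertex set Fin n.  Decidability of the edge set makes it a
-- finite set of triples that can be counted.
record 3-Graph (n : ℕ) : Set₁ where
  field
    Edge      : Pred (Subset n) 0ℓ
    edge?     : Decidable Edge
    edge-size : ∀ {e} → Edge e → ∣ e ∣ ≡ 3

open 3-Graph public

subsets : ∀ n → List (Subset n)
subsets zero    = [ Vec.[] ]
subsets (suc n) = map (inside Vec.∷_) (subsets n) ++ map (outside Vec.∷_) (subsets n)

codegree : 3-Graph n → Fin n → Fin n → ℕ
codegree {n} G x y =
  length (filter (λ e → edge? G e ×-dec x ∈? e ×-dec y ∈? e) (subsets n))

distinctPairs : ∀ n → List (Fin n × Fin n)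
distinctPairs n =
  filter (uncurry λ x y → ¬? (x ≟ y)) (cartesianProduct (allFin n) (allFin n))

-- The first argument of min is only a default: codegrees never exceed n, so for
-- n ≥ 2 this is the true minimum.  For n < 2 there are no pairs and δ₂ G = n.
δ₂ : 3-Graph n → ℕ
δ₂ {n} G = min n (map (uncurry (codegree G)) (distinctPairs n))

IsClique : 3-Graph n → Subset n → Set
IsClique G T = ∀ e → e ⊆ T → ∣ e ∣ ≡ 3 → Edge G e

K[_]-Free : ℕ → 3-Graph n → Set
K[ s ]-Free G = ¬ (∃[ T ] ∣ T ∣ ≡ s × IsClique G T)

IsSteinerTripleSystem : 3-Graph m → Set
IsSteinerTripleSystem S =
  ∀ x y → x ≢ y → ∃! _≡_ λ e → Edge S e × x ∈ e × y ∈ e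

-- Parts may be empty, which is forced when n < m.
record BalancedPartition (m n : ℕ) : Set where
  field
    part      : Fin m → Subset n
    partition : ∀ x → ∃! _≡_ λ i → x ∈ part i
    balanced  : ∀ i j → ∣ part i ∣ ≤ suc ∣ part j ∣

module Construction (S : 3-Graph m) (P : BalancedPartition m n) where
  open BalancedPartition P renaming (part to V)

  TwoOne : Pred (Subset n) 0ℓ
  TwoOne e = ∃[ i ] ∃[ j ] i ≢ j × ∣ e ∩ V i ∣ ≡ 2 × ∣ e ∩ V j ∣ ≡ 1

  Transversal : Pred (Subset n) 0ℓ
  Transversal e = ∃[ i ] ∃[ j ] ∃[ k ]
    (i ≢ j × i ≢ k × j ≢ k) ×
    (∣ e ∩ V i ∣ ≡ 1 × ∣ e ∩ V j ∣ ≡ 1 × ∣ e ∩ V k ∣ ≡ 1) ×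
    ¬ Edge S (⁅ i ⁆ ∪ ⁅ j ⁆ ∪ ⁅ k ⁆)

  twoOne? : Decidable TwoOne
  twoOne? e = any? λ i → any? λ j →
    ¬? (i ≟ j) ×-dec ∣ e ∩ V i ∣ ℕ.≟ 2 ×-dec ∣ e ∩ V j ∣ ℕ.≟ 1

  transversal? : Decidable Transversal
  transversal? e = any? λ i → any? λ j → any? λ k →
    (¬? (i ≟ j) ×-dec ¬? (i ≟ k) ×-dec ¬? (j ≟ k)) ×-dec
    (∣ e ∩ V i ∣ ℕ.≟ 1 ×-dec ∣ e ∩ V j ∣ ℕ.≟ 1 ×-dec ∣ e ∩ V k ∣ ℕ.≟ 1) ×-dec
    ¬? (edge? S (⁅ i ⁆ ∪ ⁅ j ⁆ ∪ ⁅ k ⁆))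

  graph : 3-Graph n
  graph = record
    { Edge      = λ e → ∣ e ∣ ≡ 3 × (TwoOne e ⊎ Transversal e)
    ; edge?     = λ e → ∣ e ∣ ℕ.≟ 3 ×-dec (twoOne? e ⊎-dec transversal? e)
    ; edge-size = proj₁
    }

G[_,_] : 3-Graph m → BalancedPartition m n → 3-Graph n
G[ S , P ] = Construction.graph S P

s∸2-nonZero : ∀ {s} → 5 ≤ s → NonZero (s ∸ 2)
s∸2-nonZero 5≤s = >-nonZero (≤-trans (s≤s z≤n) (∸-monoˡ-≤ 2 5≤s))

{-# OPTIONS --safe #-}
-- Every codegree of G_S is n − |V_k| or n − 2 − |V_k| for some part V_k: for x, y
-- in one part that part is V_k, and for x ∈ V_i, y ∈ V_j the index k is the third
-- point of the edge of S through i and j.  As all |V_k| are n/m + O(1), so is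
-- n minus the minimum codegree.  A clique meets each part in at most two points,
-- and the parts it meets span no edge of S, so there are at most (m + 1)/2 of
-- them; with m = s − 2 it has at most m + 1 < s points.
module Submission where

open import Data.Bool.Base using (Bool; if_then_else_; _∧_)
open import Data.Bool.Properties using (∧-identityʳ)
open import Data.Fin.Base using (Fin; zero; suc; punchIn)
open import Data.Fin.Properties using (_≟_; any?; injective⇒≤; punchInᵢ≢i; suc-injective)
open import Data.Fin.Subset
  using (Subset; inside; outside; _∈_; _∉_; _⊆_; _∩_; _∪_; ∁; ⁅_⁆; ∣_∣; ⊥; ⊤; _-_; Nonempty)
open import Data.Fin.Subset.Properties
import Data.Integer.Base as ℤ
import Data.Integer.Properties as ℤ
import Data.Integer.Solver as ℤSolver
open import Data.List.Base
  using (List; []; _∷_; length; map; filter; allFin; lookup; cartesianProduct)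
open import Data.List.Membership.Propositional using () renaming (_∈_ to _∈ˡ_)
open import Data.List.Membership.Propositional.Properties
open import Data.List.Properties using (length-map)
import Data.List.Relation.Unary.All as All
open import Data.List.Relation.Unary.All.Properties using () renaming (map⁺ to All-map⁺)
open import Data.List.Relation.Unary.AllPairs using ([]; _∷_)
open import Data.List.Relation.Unary.Any using (here; there; index)
open import Data.List.Relation.Unary.Any.Properties using (lookup-index)
open import Data.List.Relation.Unary.Unique.Propositional using (Unique)
import Data.List.Relation.Unary.Unique.Propositional.Properties as Unique
open import Data.Nat.Base using (ℕ; zero; suc; _+_; _*_; _∸_; _%_; z≤n; s≤s; NonZero; >-nonZero⁻¹)
  renaming (_≤_ to _≤ℕ_; _<_ to _<ℕ_)
open import Data.Nat.Properties as ℕ using (+-0-commutativeMonoid)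
open import Data.Nat.Solver using (module +-*-Solver)
open import Data.List.Extrema ℕ.≤-totalOrder using (argmin-sel; min≤⊤; min≤xs)
open import Data.Product using (_×_; _,_; ∃-syntax; ∃!; ∃₂; proj₁; proj₂; uncurry)
open import Data.Rational.Base as ℚ using (ℚ)
import Data.Rational.Properties as ℚ
open import Data.Rational.Unnormalised.Base as ℚᵘ using (ℚᵘ; mkℚᵘ)
import Data.Rational.Unnormalised.Properties as ℚᵘ
open import Data.Sum.Base using (_⊎_; inj₁; inj₂; [_,_]′)
open import Data.Vec.Base as Vec using (here; there)
open import Data.Vec.Properties
  using ([]=⇒lookup; lookup⇒[]=; lookup-zipWith; lookup∘tabulate; ∷-injectiveʳ)
open import Function.Base using (_∘_; case_of_; id)
open import Relation.Binary.PropositionalEquality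
  using (_≡_; _≢_; refl; sym; trans; cong; cong₂; subst; subst₂; ≢-sym; module ≡-Reasoning)
open import Relation.Nullary
  using (Dec; ¬_; ¬?; yes; no; does; contradiction; _×-dec_; decidable-stable)
open import Defs

open import Algebra.Properties.CommutativeMonoid.Sum +-0-commutativeMonoid
  using (sum; sum-remove; ∑-comm; ∑-distrib-+; sum-cong-≗; sum-replicate-zero)
open +-*-Solver using (solve; _:*_; _:+_; _:=_; con)
module ℤS = ℤSolver.+-*-Solver

private
  variable
    m n : ℕ
    A B : Set

-- Comparing lengths of duplicate-free lists.

lookup-injective : {xs : List A} → Unique xs → ∀ i j → lookup xs i ≡ lookup xs j → i ≡ j
lookup-injective (_ ∷ _)    zero    zero    _  = refl
lookup-injective (x∉ ∷ _)   zero    (suc j) eq = contradiction eq (All.lookup x∉ (∈-lookup j))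
lookup-injective (x∉ ∷ _)   (suc i) zero    eq = contradiction (sym eq) (All.lookup x∉ (∈-lookup i))
lookup-injective (_ ∷ xs!)  (suc i) (suc j) eq = cong suc (lookup-injective xs! i j eq)

-- The image of an entry may depend on its membership proof, so a relation stands in for a function.
-- Each position in `xs` goes to the position of its image in `ys`. If two positions collide,
-- injectivity of `R` equates their entries, and uniqueness of `xs` then equates the positions.
injective-relation⇒length-≤ :
  (R : A → B → Set) → (∀ {x x′ y} → R x y → R x′ y → x ≡ x′) →
  {xs : List A} {ys : List B} → Unique xs →
  (∀ {x} → x ∈ˡ xs → ∃[ y ] y ∈ˡ ys × R x y) → length xs ≤ℕ length ys
injective-relation⇒length-≤ R R-injective {xs} {ys} xs! image =
  injective⇒≤ {f = f} (λ {i} {j} → f-injective i j)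
  where
  f : Fin (length xs) → Fin (length ys)
  f i = index (proj₁ (proj₂ (image (∈-lookup i))))

  R-f : ∀ i → R (lookup xs i) (lookup ys (f i))
  R-f i = let _ , y∈ys , r = image (∈-lookup i) in subst (R _) (lookup-index y∈ys) r

  f-injective : ∀ i j → f i ≡ f j → i ≡ j
  f-injective i j eq = lookup-injective xs! i j
    (R-injective (R-f i) (subst (R _ ∘ lookup ys) (sym eq) (R-f j)))

-- Duplicate-free enumerations of subsets and of their elements.

elements : Subset n → List (Fin n)
elements Vec.[]              = []
elements (inside  Vec.∷ p)   = zero ∷ map suc (elements p)
elements (outside Vec.∷ p)   = map suc (elements p)

length-elements : (p : Subset n) → length (elements p) ≡ ∣ p ∣
length-elements Vec.[]            = refl
length-elements (inside  Vec.∷ p) = cong suc (trans (length-map suc (elements p)) (length-elements p))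
length-elements (outside Vec.∷ p) = trans (length-map suc (elements p)) (length-elements p)

∈-elements⁺ : ∀ {p : Subset n} {x} → x ∈ p → x ∈ˡ elements p
∈-elements⁺                          here        = here refl
∈-elements⁺ {p = inside  Vec.∷ _} (there x∈p) = there (∈-map⁺ suc (∈-elements⁺ x∈p))
∈-elements⁺ {p = outside Vec.∷ _} (there x∈p) = ∈-map⁺ suc (∈-elements⁺ x∈p)

∈-elements⁻ : ∀ (p : Subset n) {x} → x ∈ˡ elements p → x ∈ p
∈-elements⁻ (inside  Vec.∷ p) (here refl) = here
∈-elements⁻ (inside  Vec.∷ p) (there x∈) with _ , x∈p , refl ← ∈-map⁻ suc x∈ = there (∈-elements⁻ p x∈p)
∈-elements⁻ (outside Vec.∷ p) x∈         with _ , x∈p , refl ← ∈-map⁻ suc x∈ = there (∈-elements⁻ p x∈p)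

elements-unique : (p : Subset n) → Unique (elements p)
elements-unique Vec.[]            = []
elements-unique (inside  Vec.∷ p) =
  All-map⁺ (All.universal (λ _ ()) _) ∷ Unique.map⁺ suc-injective (elements-unique p)
elements-unique (outside Vec.∷ p) = Unique.map⁺ suc-injective (elements-unique p)

∈-subsets : (p : Subset n) → p ∈ˡ subsets n
∈-subsets Vec.[]            = here refl
∈-subsets (inside  Vec.∷ p) = ∈-++⁺ˡ (∈-map⁺ (inside Vec.∷_) (∈-subsets p))
∈-subsets (outside Vec.∷ p) = ∈-++⁺ʳ (map (inside Vec.∷_) (subsets _)) (∈-map⁺ (outside Vec.∷_) (∈-subsets p))

subsets-unique : ∀ n → Unique (subsets n)
subsets-unique zero    = All.[] ∷ []
subsets-unique (suc n) = Unique.++⁺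
  (Unique.map⁺ ∷-injectiveʳ (subsets-unique n))
  (Unique.map⁺ ∷-injectiveʳ (subsets-unique n))
  λ (p∈ , q∈) → case ∈-map⁻ (inside Vec.∷_) p∈ , ∈-map⁻ (outside Vec.∷_) q∈ of
    λ { ((_ , _ , refl) , (_ , _ , ())) }

-- Cardinalities of subsets.

-- The source of fresh points: with `p` empty, a singleton or a pair it supplies a first, second or
-- third point of `q`.
∣p∣<∣q∣⇒∃∈q∖p : ∀ {p q : Subset n} → ∣ p ∣ <ℕ ∣ q ∣ → ∃[ x ] x ∈ q × x ∉ p
∣p∣<∣q∣⇒∃∈q∖p {p = p} {q} p<q with any? (λ x → x ∈? q ×-dec ¬? (x ∈? p))
... | yes found = found
... | no  none  = contradiction p<q (ℕ.≤⇒≯ (p⊆q⇒∣p∣≤∣q∣ q⊆p))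
  where
  q⊆p : q ⊆ p
  q⊆p {x} x∈q = decidable-stable (x ∈? p) (λ x∉p → none (x , x∈q , x∉p))

p⊆q∧∣q∣≤∣p∣⇒p≡q : ∀ {p q : Subset n} → p ⊆ q → ∣ q ∣ ≤ℕ ∣ p ∣ → p ≡ q
p⊆q∧∣q∣≤∣p∣⇒p≡q {p = p} {q} p⊆q q≤p = ⊆-antisym p⊆q λ {x} x∈q →
  decidable-stable (x ∈? p) λ x∉p →
    contradiction (p⊂q⇒∣p∣<∣q∣ (p⊆q , x , x∈q , x∉p)) (ℕ.≤⇒≯ q≤p)

-- Serves to cut a 3-set out of a clique that has too many vertices in one part.
k≤∣p∣⇒∃q⊆p : ∀ {k} (p : Subset n) → k ≤ℕ ∣ p ∣ → ∃[ q ] q ⊆ p × ∣ q ∣ ≡ k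
k≤∣p∣⇒∃q⊆p {n} {zero} p _ = ⊥ , (λ x∈⊥ → contradiction x∈⊥ ∉⊥) , ∣⊥∣≡0 n
k≤∣p∣⇒∃q⊆p {k = suc k} (inside Vec.∷ p) (s≤s k≤p) =
  let q , q⊆p , ∣q∣≡k = k≤∣p∣⇒∃q⊆p p k≤p in inside Vec.∷ q , in⊆in q⊆p , cong suc ∣q∣≡k
k≤∣p∣⇒∃q⊆p {k = suc k} (outside Vec.∷ p) k≤p =
  let q , q⊆p , ∣q∣≡k = k≤∣p∣⇒∃q⊆p p k≤p in outside Vec.∷ q , out⊆ q⊆p , ∣q∣≡k

x∉p⇒∣⁅x⁆∪p∣≡1+∣p∣ : ∀ {x} (p : Subset n) → x ∉ p → ∣ ⁅ x ⁆ ∪ p ∣ ≡ suc ∣ p ∣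
x∉p⇒∣⁅x⁆∪p∣≡1+∣p∣ {x = zero}  (inside  Vec.∷ p) x∉p = contradiction here x∉p
x∉p⇒∣⁅x⁆∪p∣≡1+∣p∣ {x = zero}  (outside Vec.∷ p) x∉p = cong (suc ∘ ∣_∣) (∪-identityˡ p)
x∉p⇒∣⁅x⁆∪p∣≡1+∣p∣ {x = suc _} (inside  Vec.∷ p) x∉p = cong suc (x∉p⇒∣⁅x⁆∪p∣≡1+∣p∣ p (x∉p ∘ there))
x∉p⇒∣⁅x⁆∪p∣≡1+∣p∣ {x = suc _} (outside Vec.∷ p) x∉p = x∉p⇒∣⁅x⁆∪p∣≡1+∣p∣ p (x∉p ∘ there)

∣⁅x⁆∪p∣≤1+∣p∣ : ∀ x (p : Subset n) → ∣ ⁅ x ⁆ ∪ p ∣ ≤ℕ suc ∣ p ∣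
∣⁅x⁆∪p∣≤1+∣p∣ x p with x ∈? p
... | no  x∉p = ℕ.≤-reflexive (x∉p⇒∣⁅x⁆∪p∣≡1+∣p∣ p x∉p)
... | yes x∈p = ℕ.m≤n⇒m≤1+n (p⊆q⇒∣p∣≤∣q∣ λ y∈ →
  [ (λ y∈⁅x⁆ → subst (_∈ p) (sym (x∈⁅y⁆⇒x≡y x y∈⁅x⁆)) x∈p) , id ]′ (x∈p∪q⁻ ⁅ x ⁆ p y∈))

x∈q⇒⁅x⁆∩q≡⁅x⁆ : ∀ {x : Fin n} {q} → x ∈ q → ⁅ x ⁆ ∩ q ≡ ⁅ x ⁆
x∈q⇒⁅x⁆∩q≡⁅x⁆ {x = x} {q} x∈q = ⊆-antisym (p∩q⊆p ⁅ x ⁆ q)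
  λ y∈⁅x⁆ → x∈p∩q⁺ (y∈⁅x⁆ , subst (_∈ q) (sym (x∈⁅y⁆⇒x≡y x y∈⁅x⁆)) x∈q)

x∉q⇒⁅x⁆∩q≡⊥ : ∀ {x : Fin n} {q} → x ∉ q → ⁅ x ⁆ ∩ q ≡ ⊥
x∉q⇒⁅x⁆∩q≡⊥ {x = x} {q} x∉q = Empty-unique λ (_ , y∈) →
  let y∈⁅x⁆ , y∈q = x∈p∩q⁻ ⁅ x ⁆ q y∈ in x∉q (subst (_∈ q) (x∈⁅y⁆⇒x≡y x y∈⁅x⁆) y∈q)

x∈q⇒∣⁅x⁆∩q∣≡1 : ∀ {x : Fin n} {q} → x ∈ q → ∣ ⁅ x ⁆ ∩ q ∣ ≡ 1
x∈q⇒∣⁅x⁆∩q∣≡1 {x = x} x∈q = trans (cong ∣_∣ (x∈q⇒⁅x⁆∩q≡⁅x⁆ x∈q)) (∣⁅x⁆∣≡1 x)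

x∉q⇒∣⁅x⁆∩q∣≡0 : ∀ {x : Fin n} {q} → x ∉ q → ∣ ⁅ x ⁆ ∩ q ∣ ≡ 0
x∉q⇒∣⁅x⁆∩q∣≡0 {n} x∉q = trans (cong ∣_∣ (x∉q⇒⁅x⁆∩q≡⊥ x∉q)) (∣⊥∣≡0 n)

x∉p⇒∣[⁅x⁆∪p]∩q∣≡∣⁅x⁆∩q∣+∣p∩q∣ : ∀ {x : Fin n} p q → x ∉ p →
                                  ∣ (⁅ x ⁆ ∪ p) ∩ q ∣ ≡ ∣ ⁅ x ⁆ ∩ q ∣ + ∣ p ∩ q ∣
x∉p⇒∣[⁅x⁆∪p]∩q∣≡∣⁅x⁆∩q∣+∣p∩q∣ {n} {x} p q x∉p = begin
  ∣ (⁅ x ⁆ ∪ p) ∩ q ∣        ≡⟨ cong ∣_∣ (∩-distribʳ-∪ q ⁅ x ⁆ p) ⟩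
  ∣ (⁅ x ⁆ ∩ q) ∪ (p ∩ q) ∣  ≡⟨ split ⟩
  ∣ ⁅ x ⁆ ∩ q ∣ + ∣ p ∩ q ∣  ∎
  where
  open ≡-Reasoning
  split : ∣ (⁅ x ⁆ ∩ q) ∪ (p ∩ q) ∣ ≡ ∣ ⁅ x ⁆ ∩ q ∣ + ∣ p ∩ q ∣
  split with x ∈? q
  ... | yes x∈q rewrite x∈q⇒⁅x⁆∩q≡⁅x⁆ x∈q | ∣⁅x⁆∣≡1 x = x∉p⇒∣⁅x⁆∪p∣≡1+∣p∣ (p ∩ q) (x∉p ∘ p∩q⊆p p q)
  ... | no  x∉q rewrite x∉q⇒⁅x⁆∩q≡⊥ x∉q | ∣⊥∣≡0 n = cong ∣_∣ (∪-identityˡ (p ∩ q))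

-- If `x` were in `p - x`, deleting it once more would shrink the set strictly, but a second
-- deletion changes nothing.
x∉p-x : ∀ {x : Fin n} p → x ∉ p - x
x∉p-x {x = x} p x∈p-x = ℕ.<-irrefl (cong ∣_∣ (p─q─q≡p─q p ⁅ x ⁆)) (x∈p⇒∣p-x∣<∣p∣ x∈p-x)

-- Three-element subsets.

triple : Fin n → Fin n → Fin n → Subset n
triple x y z = ⁅ x ⁆ ∪ ⁅ y ⁆ ∪ ⁅ z ⁆

∈-triple⁻ : ∀ {w} (x y z : Fin n) → w ∈ triple x y z → w ≡ x ⊎ w ≡ y ⊎ w ≡ z
∈-triple⁻ x y z w∈ with x∈p∪q⁻ ⁅ x ⁆ (⁅ y ⁆ ∪ ⁅ z ⁆) w∈
... | inj₁ w∈⁅x⁆ = inj₁ (x∈⁅y⁆⇒x≡y x w∈⁅x⁆)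
... | inj₂ w∈′ with x∈p∪q⁻ ⁅ y ⁆ ⁅ z ⁆ w∈′
...   | inj₁ w∈⁅y⁆ = inj₂ (inj₁ (x∈⁅y⁆⇒x≡y y w∈⁅y⁆))
...   | inj₂ w∈⁅z⁆ = inj₂ (inj₂ (x∈⁅y⁆⇒x≡y z w∈⁅z⁆))

∈-triple₁ : ∀ (x y z : Fin n) → x ∈ triple x y z
∈-triple₁ x y z = x∈p∪q⁺ (inj₁ (x∈⁅x⁆ x))

∈-triple₂ : ∀ (x y z : Fin n) → y ∈ triple x y z
∈-triple₂ x y z = x∈p∪q⁺ (inj₂ (x∈p∪q⁺ (inj₁ (x∈⁅x⁆ y))))

∈-triple₃ : ∀ (x y z : Fin n) → z ∈ triple x y z
∈-triple₃ x y z = x∈p∪q⁺ (inj₂ (x∈p∪q⁺ {p = ⁅ y ⁆} (inj₂ (x∈⁅x⁆ z))))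

triple⊆ : ∀ {x y z} {p : Subset n} → x ∈ p → y ∈ p → z ∈ p → triple x y z ⊆ p
triple⊆ {x = x} {y} {z} x∈p y∈p z∈p w∈ with ∈-triple⁻ x y z w∈
... | inj₁ refl        = x∈p
... | inj₂ (inj₁ refl) = y∈p
... | inj₂ (inj₂ refl) = z∈p

x∉⁅y⁆∪⁅z⁆ : ∀ {x y z : Fin n} → x ≢ y → x ≢ z → x ∉ ⁅ y ⁆ ∪ ⁅ z ⁆
x∉⁅y⁆∪⁅z⁆ {y = y} {z} x≢y x≢z x∈ with x∈p∪q⁻ ⁅ y ⁆ ⁅ z ⁆ x∈
... | inj₁ x∈⁅y⁆ = x≢y (x∈⁅y⁆⇒x≡y y x∈⁅y⁆)
... | inj₂ x∈⁅z⁆ = x≢z (x∈⁅y⁆⇒x≡y z x∈⁅z⁆)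

∣⁅x⁆∪⁅y⁆∣≤2 : ∀ (x y : Fin n) → ∣ ⁅ x ⁆ ∪ ⁅ y ⁆ ∣ ≤ℕ 2
∣⁅x⁆∪⁅y⁆∣≤2 x y = ℕ.≤-trans (∣⁅x⁆∪p∣≤1+∣p∣ x ⁅ y ⁆) (s≤s (ℕ.≤-reflexive (∣⁅x⁆∣≡1 y)))

∣triple∣≡3 : ∀ {x y z : Fin n} → x ≢ y → x ≢ z → y ≢ z → ∣ triple x y z ∣ ≡ 3
∣triple∣≡3 {x = x} {y} {z} x≢y x≢z y≢z =
  trans (x∉p⇒∣⁅x⁆∪p∣≡1+∣p∣ _ (x∉⁅y⁆∪⁅z⁆ x≢y x≢z))
        (cong suc (trans (x∉p⇒∣⁅x⁆∪p∣≡1+∣p∣ ⁅ z ⁆ (x≢y⇒x∉⁅y⁆ y≢z)) (cong suc (∣⁅x⁆∣≡1 z))))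

∣triple∩q∣ : ∀ {x y z : Fin n} q → x ≢ y → x ≢ z → y ≢ z →
             ∣ triple x y z ∩ q ∣ ≡ ∣ ⁅ x ⁆ ∩ q ∣ + (∣ ⁅ y ⁆ ∩ q ∣ + ∣ ⁅ z ⁆ ∩ q ∣)
∣triple∩q∣ {z = z} q x≢y x≢z y≢z =
  trans (x∉p⇒∣[⁅x⁆∪p]∩q∣≡∣⁅x⁆∩q∣+∣p∩q∣ _ q (x∉⁅y⁆∪⁅z⁆ x≢y x≢z))
        (cong (_ +_) (x∉p⇒∣[⁅x⁆∪p]∩q∣≡∣⁅x⁆∩q∣+∣p∩q∣ ⁅ z ⁆ q (x≢y⇒x∉⁅y⁆ y≢z)))

-- Three distinct points exhaust a 3-set. This turns an abstract edge into an explicit triple.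
∣p∣≡3⇒triple≡p : ∀ {x y z} {p : Subset n} → ∣ p ∣ ≡ 3 → x ≢ y → x ≢ z → y ≢ z →
                 x ∈ p → y ∈ p → z ∈ p → triple x y z ≡ p
∣p∣≡3⇒triple≡p ∣p∣≡3 x≢y x≢z y≢z x∈p y∈p z∈p = p⊆q∧∣q∣≤∣p∣⇒p≡q (triple⊆ x∈p y∈p z∈p)
  (ℕ.≤-reflexive (trans ∣p∣≡3 (sym (∣triple∣≡3 x≢y x≢z y≢z))))

-- The set of `x` and `y` has at most two elements, so it cannot cover `p`. The two points may
-- coincide, which yields a second point of `p`.
∣p∣≡3⇒∃third : ∀ {p : Subset n} → ∣ p ∣ ≡ 3 → ∀ x y → ∃[ z ] z ∈ p × x ≢ z × y ≢ z
∣p∣≡3⇒∃third {p = p} ∣p∣≡3 x y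
  with z , z∈p , z∉ ← ∣p∣<∣q∣⇒∃∈q∖p {p = ⁅ x ⁆ ∪ ⁅ y ⁆} {p}
                        (subst (_ <ℕ_) (sym ∣p∣≡3) (s≤s (∣⁅x⁆∪⁅y⁆∣≤2 x y)))
  = z , z∈p , (λ { refl → z∉ (x∈p∪q⁺ (inj₁ (x∈⁅x⁆ x))) })
            , (λ { refl → z∉ (x∈p∪q⁺ {p = ⁅ x ⁆} (inj₂ (x∈⁅x⁆ y))) })

1≤∣p∣⇒∃∈p : ∀ {p : Subset n} → 1 ≤ℕ ∣ p ∣ → ∃[ x ] x ∈ p
1≤∣p∣⇒∃∈p {n} {p} 1≤∣p∣ =
  let x , x∈p , _ = ∣p∣<∣q∣⇒∃∈q∖p {p = ⊥} {p} (subst (_<ℕ ∣ p ∣) (sym (∣⊥∣≡0 n)) 1≤∣p∣) in x , x∈p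

2≤∣p∣⇒∃₂∈p : ∀ {p : Subset n} → 2 ≤ℕ ∣ p ∣ → ∃₂ λ x y → x ∈ p × y ∈ p × y ≢ x
2≤∣p∣⇒∃₂∈p {p = p} 2≤∣p∣ =
  let x , x∈p = 1≤∣p∣⇒∃∈p {p = p} (ℕ.≤-trans (s≤s z≤n) 2≤∣p∣)
      y , y∈p , y∉⁅x⁆ = ∣p∣<∣q∣⇒∃∈q∖p {p = ⁅ x ⁆} {p} (subst (_<ℕ ∣ p ∣) (sym (∣⁅x⁆∣≡1 x)) 2≤∣p∣)
  in x , y , x∈p , y∈p , x∉⁅y⁆⇒x≢y y∉⁅x⁆

-- Finite sums and counting along a partition.

χ : Bool → ℕ
χ b = if b then 1 else 0

∣p∣≡∑χ : (p : Subset n) → ∣ p ∣ ≡ sum (χ ∘ Vec.lookup p)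
∣p∣≡∑χ Vec.[]            = refl
∣p∣≡∑χ (inside  Vec.∷ p) = cong suc (∣p∣≡∑χ p)
∣p∣≡∑χ (outside Vec.∷ p) = ∣p∣≡∑χ p

sum-zero : (f : Fin n → ℕ) → (∀ i → f i ≡ 0) → sum f ≡ 0
sum-zero {n} f f≡0 = trans (sum-cong-≗ f≡0) (sum-replicate-zero n)

sum-single : (f : Fin n → ℕ) (i : Fin n) → (∀ j → j ≢ i → f j ≡ 0) → sum f ≡ f i
sum-single {suc n} f i f≡0 = begin
  sum f                        ≡⟨ sum-remove {i = i} f ⟩
  f i + sum (f ∘ punchIn i)    ≡⟨ cong (f i +_) (sum-zero _ λ j → f≡0 _ (punchInᵢ≢i i j)) ⟩
  f i + 0                      ≡⟨ ℕ.+-identityʳ (f i) ⟩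
  f i                          ∎
  where open ≡-Reasoning

sum-mono-≤ : {f g : Fin n → ℕ} → (∀ i → f i ≤ℕ g i) → sum f ≤ℕ sum g
sum-mono-≤ {zero}  f≤g = z≤n
sum-mono-≤ {suc n} f≤g = ℕ.+-mono-≤ (f≤g zero) (sum-mono-≤ (f≤g ∘ suc))

sum-const : ∀ n c → sum {n} (λ _ → c) ≡ n * c
sum-const zero    c = refl
sum-const (suc n) c = cong (c +_) (sum-const n c)

x∉p⇒lookup≡outside : ∀ {x} {p : Subset n} → x ∉ p → Vec.lookup p x ≡ outside
x∉p⇒lookup≡outside {x = x} {p} x∉p with Vec.lookup p x in eq
... | outside = refl
... | inside  = contradiction (lookup⇒[]= x p eq) x∉p

-- Double counting of pairs of a point of `p` and a part containing it: both sides become sums of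
-- indicators, the order of summation is exchanged, and each point contributes only through its
-- unique part.
∣p∣≡∑∣p∩V∣ : (V : Fin m → Subset n) → (∀ x → ∃! _≡_ λ i → x ∈ V i) →
             (p : Subset n) → ∣ p ∣ ≡ sum λ i → ∣ p ∩ V i ∣
∣p∣≡∑∣p∩V∣ {m} {n} V partition p = begin
  ∣ p ∣                                              ≡⟨ ∣p∣≡∑χ p ⟩
  sum (λ x → χ (Vec.lookup p x))                     ≡⟨ sum-cong-≗ by-part ⟩
  sum (λ x → sum λ i → χ (Vec.lookup (p ∩ V i) x))   ≡⟨ ∑-comm (λ x i → χ (Vec.lookup (p ∩ V i) x)) ⟩
  sum (λ i → sum λ x → χ (Vec.lookup (p ∩ V i) x))   ≡⟨ sum-cong-≗ (λ i → ∣p∣≡∑χ (p ∩ V i)) ⟨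
  sum (λ i → ∣ p ∩ V i ∣)                            ∎
  where
  open ≡-Reasoning
  by-part : ∀ x → χ (Vec.lookup p x) ≡ sum λ i → χ (Vec.lookup (p ∩ V i) x)
  by-part x with i , x∈Vᵢ , unique ← partition x = sym (begin
    sum (λ j → χ (Vec.lookup (p ∩ V j) x))   ≡⟨ sum-single _ i (λ j j≢i → cong χ (x∉p⇒lookup≡outside λ x∈ →
                                                  j≢i (sym (unique (p∩q⊆q p (V j) x∈))))) ⟩
    χ (Vec.lookup (p ∩ V i) x)               ≡⟨ cong χ (lookup-zipWith _∧_ x p (V i)) ⟩
    χ (Vec.lookup p x ∧ Vec.lookup (V i) x)  ≡⟨ cong (λ b → χ (Vec.lookup p x ∧ b)) ([]=⇒lookup x∈Vᵢ) ⟩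
    χ (Vec.lookup p x ∧ inside)              ≡⟨ cong χ (∧-identityʳ (Vec.lookup p x)) ⟩
    χ (Vec.lookup p x)                       ∎)

-- Independent sets in Steiner triple systems.

IsIndependent : 3-Graph n → Subset n → Set
IsIndependent S I = ∀ {e} → e ⊆ I → ¬ Edge S e

module SteinerTripleSystem (S : 3-Graph m) (steiner : IsSteinerTripleSystem S) where

  edge-through-unique : ∀ {x y e e′} → x ≢ y → Edge S e → Edge S e′ →
                        x ∈ e → y ∈ e → x ∈ e′ → y ∈ e′ → e ≡ e′
  edge-through-unique x≢y Se Se′ x∈e y∈e x∈e′ y∈e′ =
    let _ , _ , unique = steiner _ _ x≢y
    in trans (sym (unique (Se , x∈e , y∈e))) (unique (Se′ , x∈e′ , y∈e′))

  -- The product of two distinct points in the Steiner quasigroup of `S`.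
  third : ∀ {x y} → x ≢ y → ∃[ z ] x ≢ z × y ≢ z × Edge S (triple x y z)
  third {x} {y} x≢y =
    let e , (Se , x∈e , y∈e) , _ = steiner x y x≢y
        z , z∈e , x≢z , y≢z = ∣p∣≡3⇒∃third (edge-size S Se) x y
    in z , x≢z , y≢z , subst (Edge S) (sym (∣p∣≡3⇒triple≡p (edge-size S Se) x≢y x≢z y≢z x∈e y∈e z∈e)) Se

  -- Both triples are edges through `x` and `y`, hence the same set; so `w` lies in the first one,
  -- and it differs from `x` and `y`.
  third-unique : ∀ {x y z w} → x ≢ y → x ≢ w → y ≢ w →
                 Edge S (triple x y z) → Edge S (triple x y w) → w ≡ z
  third-unique {x} {y} {z} {w} x≢y x≢w y≢w Sxyz Sxyw
    with ∈-triple⁻ x y z (subst (w ∈_) (edge-through-unique x≢y Sxyw Sxyz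
           (∈-triple₁ x y w) (∈-triple₂ x y w) (∈-triple₁ x y z) (∈-triple₂ x y z)) (∈-triple₃ x y w))
  ... | inj₁ refl        = contradiction refl x≢w
  ... | inj₂ (inj₁ refl) = contradiction refl y≢w
  ... | inj₂ (inj₂ w≡z)  = w≡z

  -- For x in I, sending y to the third point of the edge through x and y
  -- injects I ∖ {x} into the complement of I.
  2∣I∣≤1+m : ∀ {I} → IsIndependent S I → ∣ I ∣ + ∣ I ∣ ≤ℕ suc m
  2∣I∣≤1+m {I} independent with nonempty? I
  ... | no  empty     = subst (λ p → ∣ p ∣ + ∣ p ∣ ≤ℕ suc m) (sym (Empty-unique empty))
                          (subst (λ k → k + k ≤ℕ suc m) (sym (∣⊥∣≡0 m)) z≤n)
  ... | yes (x , x∈I) = begin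
    ∣ I ∣ + ∣ I ∣              ≤⟨ ℕ.+-monoˡ-≤ ∣ I ∣ ∣I∣≤1+∣I-x∣ ⟩
    suc (∣ I - x ∣ + ∣ I ∣)    ≤⟨ s≤s (ℕ.+-monoˡ-≤ ∣ I ∣ ∣I-x∣≤∣∁I∣) ⟩
    suc (∣ ∁ I ∣ + ∣ I ∣)      ≡⟨ cong (λ k → suc (k + ∣ I ∣)) (∣∁p∣≡n∸∣p∣ I) ⟩
    suc (m ∸ ∣ I ∣ + ∣ I ∣)    ≡⟨ cong suc (ℕ.m∸n+n≡m (∣p∣≤n I)) ⟩
    suc m                      ∎
    where
    open ℕ.≤-Reasoning

    ∣I∣≤1+∣I-x∣ : ∣ I ∣ ≤ℕ suc ∣ I - x ∣
    ∣I∣≤1+∣I-x∣ = ℕ.≤-trans (p⊆q⇒∣p∣≤∣q∣ I⊆) (∣⁅x⁆∪p∣≤1+∣p∣ x (I - x))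
      where
      I⊆ : I ⊆ ⁅ x ⁆ ∪ (I - x)
      I⊆ {y} y∈I with y ≟ x
      ... | yes refl = x∈p∪q⁺ (inj₁ (x∈⁅x⁆ x))
      ... | no  y≢x  = x∈p∪q⁺ {p = ⁅ x ⁆} (inj₂ (x∈p∧x≢y⇒x∈p-y y∈I y≢x))

    -- The triple is ordered `x z y`, so that injectivity becomes uniqueness of the third point on
    -- the edge through `x` and `z`.
    IsThird : Fin m → Fin m → Set
    IsThird y z = x ≢ y × x ≢ z × y ≢ z × Edge S (triple x z y)

    image : ∀ {y} → y ∈ˡ elements (I - x) → ∃[ z ] z ∈ˡ elements (∁ I) × IsThird y z
    image {y} y∈ =
      let y∈I-x = ∈-elements⁻ (I - x) y∈
          y∈I = p─q⊆p I ⁅ x ⁆ y∈I-x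
          x≢y = λ x≡y → x∉p-x I (subst (_∈ I - x) (sym x≡y) y∈I-x)
          z , x≢z , y≢z , Sxyz = third x≢y
      -- Were `z` in `I`, the whole edge would lie in `I`, against independence.
      in z , ∈-elements⁺ (x∉p⇒x∈∁p λ z∈I → independent (triple⊆ x∈I y∈I z∈I) Sxyz)
           , x≢y , x≢z , y≢z , subst (Edge S) (cong (⁅ x ⁆ ∪_) (∪-comm ⁅ y ⁆ ⁅ z ⁆)) Sxyz

    ∣I-x∣≤∣∁I∣ : ∣ I - x ∣ ≤ℕ ∣ ∁ I ∣
    ∣I-x∣≤∣∁I∣ = subst₂ _≤ℕ_ (length-elements (I - x)) (length-elements (∁ I))
      (injective-relation⇒length-≤ IsThird
        (λ (x≢y , x≢z , y≢z , Sxzy) (_ , _ , _ , Sxzy′) →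
          third-unique x≢z x≢y (≢-sym y≢z) Sxzy′ Sxzy)
        (elements-unique (I - x)) image)

-- Codegrees in an arbitrary 3-graph.

module Codegree (G : 3-Graph n) {x y : Fin n} (x≢y : x ≢ y) where

  through? : ∀ e → Dec (Edge G e × x ∈ e × y ∈ e)
  through? e = edge? G e ×-dec x ∈? e ×-dec y ∈? e

  -- Matches a vertex with the triple it forms with `x` and `y`. It is injective in both directions,
  -- so codegrees can be bounded from above and from below by counting third vertices.
  Completes : Fin n → Subset n → Set
  Completes z e = x ≢ z × y ≢ z × e ≡ triple x y z

  completes-injective : ∀ {z z′ e} → Completes z e → Completes z′ e → z ≡ z′
  completes-injective {z} {z′} (x≢z , y≢z , refl) (x≢z′ , y≢z′ , eq)
    with ∈-triple⁻ x y z′ (subst (z ∈_) eq (∈-triple₃ x y z))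
  ... | inj₁ refl        = contradiction refl x≢z
  ... | inj₂ (inj₁ refl) = contradiction refl y≢z
  ... | inj₂ (inj₂ z≡z′) = z≡z′

  codegree-≤ : (p : Subset n) →
               (∀ {z} → x ≢ z → y ≢ z → Edge G (triple x y z) → z ∈ p) →
               codegree G x y ≤ℕ ∣ p ∣
  codegree-≤ p completions⊆p = subst (codegree G x y ≤ℕ_) (length-elements p)
    (injective-relation⇒length-≤ (λ e z → Completes z e)
      (λ (_ , _ , e≡) (_ , _ , e′≡) → trans e≡ (sym e′≡))
      (Unique.filter⁺ through? (subsets-unique n)) image)
    where
    image : ∀ {e} → e ∈ˡ filter through? (subsets n) → ∃[ z ] z ∈ˡ elements p × Completes z e
    image {e} e∈ =
      let _ , Ge , x∈e , y∈e = ∈-filter⁻ through? {xs = subsets n} e∈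
          z , z∈e , x≢z , y≢z = ∣p∣≡3⇒∃third (edge-size G Ge) x y
          xyz≡e = ∣p∣≡3⇒triple≡p (edge-size G Ge) x≢y x≢z y≢z x∈e y∈e z∈e
      in z , ∈-elements⁺ (completions⊆p x≢z y≢z (subst (Edge G) (sym xyz≡e) Ge)) , x≢z , y≢z , sym xyz≡e

  codegree-≥ : (p : Subset n) →
               (∀ {z} → z ∈ p → x ≢ z × y ≢ z × Edge G (triple x y z)) →
               ∣ p ∣ ≤ℕ codegree G x y
  codegree-≥ p p⊆completions = subst (_≤ℕ codegree G x y) (length-elements p)
    (injective-relation⇒length-≤ Completes completes-injective (elements-unique p) image)
    where
    image : ∀ {z} → z ∈ˡ elements p → ∃[ e ] e ∈ˡ filter through? (subsets n) × Completes z e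
    image {z} z∈ =
      let x≢z , y≢z , Gxyz = p⊆completions (∈-elements⁻ p z∈)
      in triple x y z
       , ∈-filter⁺ through? (∈-subsets _) (Gxyz , ∈-triple₁ x y z , ∈-triple₂ x y z)
       , x≢z , y≢z , refl

  -- The third vertices of edges through `x` and `y` are exactly those outside `p` other than `x`
  -- and `y`. The slack of 2 is there because `x` and `y` may or may not already lie in `p`. The
  -- additive form avoids truncated subtraction.
  codegree-bounds : (p : Subset n) →
    (∀ {z} → x ≢ z → y ≢ z → Edge G (triple x y z) → z ∉ p) →
    (∀ {z} → x ≢ z → y ≢ z → z ∉ p → Edge G (triple x y z)) →
    codegree G x y + ∣ p ∣ ≤ℕ n × n ≤ℕ 2 + codegree G x y + ∣ p ∣
  codegree-bounds p avoids covers = upper , lower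
    where
    open ℕ.≤-Reasoning
    c = codegree G x y
    q = ⁅ x ⁆ ∪ ⁅ y ⁆ ∪ p

    upper : c + ∣ p ∣ ≤ℕ n
    upper = begin
      c + ∣ p ∣          ≤⟨ ℕ.+-monoˡ-≤ ∣ p ∣ (codegree-≤ (∁ p) λ x≢z y≢z Gxyz → x∉p⇒x∈∁p (avoids x≢z y≢z Gxyz)) ⟩
      ∣ ∁ p ∣ + ∣ p ∣    ≡⟨ cong (_+ ∣ p ∣) (∣∁p∣≡n∸∣p∣ p) ⟩
      n ∸ ∣ p ∣ + ∣ p ∣  ≡⟨ ℕ.m∸n+n≡m (∣p∣≤n p) ⟩
      n                  ∎

    z∈∁q⇒ : ∀ {z} → z ∈ ∁ q → x ≢ z × y ≢ z × Edge G (triple x y z)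
    z∈∁q⇒ {z} z∈∁q = x≢z , y≢z , covers x≢z y≢z (z∉q ∘ x∈p∪q⁺ {p = ⁅ x ⁆} ∘ inj₂ ∘ x∈p∪q⁺ {p = ⁅ y ⁆} ∘ inj₂)
      where
      z∉q = x∈∁p⇒x∉p z∈∁q
      x≢z : x ≢ z
      x≢z refl = z∉q (x∈p∪q⁺ (inj₁ (x∈⁅x⁆ x)))
      y≢z : y ≢ z
      y≢z refl = z∉q (x∈p∪q⁺ {p = ⁅ x ⁆} (inj₂ (x∈p∪q⁺ (inj₁ (x∈⁅x⁆ y)))))

    lower : n ≤ℕ 2 + c + ∣ p ∣
    lower = begin
      n                    ≡⟨ ℕ.m∸n+n≡m (∣p∣≤n q) ⟨
      n ∸ ∣ q ∣ + ∣ q ∣    ≡⟨ cong (_+ ∣ q ∣) (∣∁p∣≡n∸∣p∣ q) ⟨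
      ∣ ∁ q ∣ + ∣ q ∣      ≤⟨ ℕ.+-mono-≤ (codegree-≥ (∁ q) z∈∁q⇒)
                                (ℕ.≤-trans (∣⁅x⁆∪p∣≤1+∣p∣ x _) (s≤s (∣⁅x⁆∪p∣≤1+∣p∣ y p))) ⟩
      c + (2 + ∣ p ∣)      ≡⟨ ℕ.+-assoc c 2 ∣ p ∣ ⟨
      c + 2 + ∣ p ∣        ≡⟨ cong (_+ ∣ p ∣) (ℕ.+-comm c 2) ⟩
      2 + c + ∣ p ∣        ∎

-- Separates the orders that have a pair of vertices from those where `δ₂` takes its default value.
distinct-or-small : ∀ n → (∃₂ λ (x y : Fin n) → x ≢ y) ⊎ n ≤ℕ 1
distinct-or-small 0             = inj₂ z≤n
distinct-or-small 1             = inj₂ (s≤s z≤n)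
distinct-or-small (suc (suc n)) = inj₁ (zero , suc zero , λ ())

-- The blow-up: its projection `π` onto the points of `S`, and its non-edges.

module BlowUp (S : 3-Graph m) (steiner : IsSteinerTripleSystem S) (P : BalancedPartition m n) where
  open BalancedPartition P renaming (part to V)
  open SteinerTripleSystem S steiner
  open Construction S P using (TwoOne; Transversal)

  G : 3-Graph n
  G = G[ S , P ]

  π : Fin n → Fin m
  π x = proj₁ (partition x)

  x∈Vπ : ∀ x → x ∈ V (π x)
  x∈Vπ x = proj₁ (proj₂ (partition x))

  x∈V⇒π≡ : ∀ {x i} → x ∈ V i → π x ≡ i
  x∈V⇒π≡ {x} = proj₂ (proj₂ (partition x))

  π≢⇒x≢ : ∀ {x y} → π x ≢ π y → x ≢ y
  π≢⇒x≢ πx≢πy refl = πx≢πy refl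

  ∣⁅x⁆∩V∣≡1 : ∀ x {i} → π x ≡ i → ∣ ⁅ x ⁆ ∩ V i ∣ ≡ 1
  ∣⁅x⁆∩V∣≡1 x refl = x∈q⇒∣⁅x⁆∩q∣≡1 (x∈Vπ x)

  ∣⁅x⁆∩V∣≡0 : ∀ x {i} → π x ≢ i → ∣ ⁅ x ⁆ ∩ V i ∣ ≡ 0
  ∣⁅x⁆∩V∣≡0 x πx≢i = x∉q⇒∣⁅x⁆∩q∣≡0 (πx≢i ∘ x∈V⇒π≡)

  ∣p∩V∣≥1⇒∃ : ∀ p i → 1 ≤ℕ ∣ p ∩ V i ∣ → ∃[ x ] x ∈ p × π x ≡ i
  ∣p∩V∣≥1⇒∃ p i 1≤ =
    let x , x∈ = 1≤∣p∣⇒∃∈p {p = p ∩ V i} 1≤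
        x∈p , x∈V = x∈p∩q⁻ p (V i) x∈
    in x , x∈p , x∈V⇒π≡ x∈V

  -- Edges of either kind come with two distinct indices whose parts they meet; this is what
  -- excludes triples inside one part.
  edge-meets-two-parts : ∀ {e} → Edge G e → ∃₂ λ x y → x ∈ e × y ∈ e × π x ≢ π y
  edge-meets-two-parts {e} (_ , e-type) = two-parts e-type
    where
    from-parts : ∀ i j → i ≢ j → 1 ≤ℕ ∣ e ∩ V i ∣ → 1 ≤ℕ ∣ e ∩ V j ∣ → ∃₂ λ x y → x ∈ e × y ∈ e × π x ≢ π y
    from-parts i j i≢j i-hit j-hit
      with x , x∈e , refl ← ∣p∩V∣≥1⇒∃ e i i-hit
      with y , y∈e , refl ← ∣p∩V∣≥1⇒∃ e j j-hit
      = x , y , x∈e , y∈e , i≢j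

    two-parts : TwoOne e ⊎ Transversal e → ∃₂ λ x y → x ∈ e × y ∈ e × π x ≢ π y
    two-parts (inj₁ (i , j , i≢j , ∣e∩Vᵢ∣≡2 , ∣e∩Vⱼ∣≡1)) =
      from-parts i j i≢j (subst (1 ≤ℕ_) (sym ∣e∩Vᵢ∣≡2) (s≤s z≤n)) (ℕ.≤-reflexive (sym ∣e∩Vⱼ∣≡1))
    two-parts (inj₂ (i , j , k , (i≢j , _) , (∣e∩Vᵢ∣≡1 , ∣e∩Vⱼ∣≡1 , _) , _)) =
      from-parts i j i≢j (ℕ.≤-reflexive (sym ∣e∩Vᵢ∣≡1)) (ℕ.≤-reflexive (sym ∣e∩Vⱼ∣≡1))

  within-part⇒¬edge : ∀ {e i} → e ⊆ V i → ¬ Edge G e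
  within-part⇒¬edge e⊆V Ge =
    let _ , _ , x∈e , y∈e , πx≢πy = edge-meets-two-parts Ge
    in πx≢πy (trans (x∈V⇒π≡ (e⊆V x∈e)) (sym (x∈V⇒π≡ (e⊆V y∈e))))

  module _ {x y z : Fin n} (πx≢πy : π x ≢ π y) (πx≢πz : π x ≢ π z) (πy≢πz : π y ≢ π z) where

    π-injective-on-triple : ∀ {u v} → u ∈ triple x y z → v ∈ triple x y z → π u ≡ π v → u ≡ v
    π-injective-on-triple u∈ v∈ eq with ∈-triple⁻ x y z u∈ | ∈-triple⁻ x y z v∈
    ... | inj₁ refl        | inj₁ refl        = refl
    ... | inj₁ refl        | inj₂ (inj₁ refl) = contradiction eq πx≢πy
    ... | inj₁ refl        | inj₂ (inj₂ refl) = contradiction eq πx≢πz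
    ... | inj₂ (inj₁ refl) | inj₁ refl        = contradiction (sym eq) πx≢πy
    ... | inj₂ (inj₁ refl) | inj₂ (inj₁ refl) = refl
    ... | inj₂ (inj₁ refl) | inj₂ (inj₂ refl) = contradiction eq πy≢πz
    ... | inj₂ (inj₂ refl) | inj₁ refl        = contradiction (sym eq) πx≢πz
    ... | inj₂ (inj₂ refl) | inj₂ (inj₁ refl) = contradiction (sym eq) πy≢πz
    ... | inj₂ (inj₂ refl) | inj₂ (inj₂ refl) = refl

    π-triple : ∀ {u} → u ∈ triple x y z → π u ∈ triple (π x) (π y) (π z)
    π-triple u∈ with ∈-triple⁻ x y z u∈
    ... | inj₁ refl        = ∈-triple₁ (π x) (π y) (π z)
    ... | inj₂ (inj₁ refl) = ∈-triple₂ (π x) (π y) (π z)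
    ... | inj₂ (inj₂ refl) = ∈-triple₃ (π x) (π y) (π z)

    -- The vertices lie in three different parts, so no part holds two of them and `TwoOne` fails.
    -- In the `Transversal` case the indices may come in any order, but being distinct they exhaust
    -- the set of projections, which is an edge of `S`.
    over-edge⇒¬edge : Edge S (triple (π x) (π y) (π z)) → ¬ Edge G (triple x y z)
    over-edge⇒¬edge Sπ (_ , inj₁ (i , _ , _ , ∣e∩Vᵢ∣≡2 , _)) =
      let u , v , u∈ , v∈ , v≢u = 2≤∣p∣⇒∃₂∈p {p = triple x y z ∩ V i} (ℕ.≤-reflexive (sym ∣e∩Vᵢ∣≡2))
          u∈e , u∈V = x∈p∩q⁻ _ (V i) u∈
          v∈e , v∈V = x∈p∩q⁻ _ (V i) v∈
      in v≢u (π-injective-on-triple v∈e u∈e (trans (x∈V⇒π≡ v∈V) (sym (x∈V⇒π≡ u∈V))))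
    over-edge⇒¬edge Sπ (_ , inj₂ (i , j , k , (i≢j , i≢k , j≢k) , (cᵢ , cⱼ , cₖ) , ¬Sijk)) =
      ¬Sijk (subst (Edge S) (sym (∣p∣≡3⇒triple≡p (∣triple∣≡3 πx≢πy πx≢πz πy≢πz) i≢j i≢k j≢k
        (hit cᵢ) (hit cⱼ) (hit cₖ))) Sπ)
      where
      hit : ∀ {i} → ∣ triple x y z ∩ V i ∣ ≡ 1 → i ∈ triple (π x) (π y) (π z)
      hit {i} c≡1 with ∣p∩V∣≥1⇒∃ (triple x y z) i (ℕ.≤-reflexive (sym c≡1))
      ... | u , u∈ , refl = π-triple u∈

  -- The size of a clique.

  clique-size : ∀ {T} → IsClique G T → ∣ T ∣ ≤ℕ suc m
  clique-size {T} clique = begin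
    ∣ T ∣                                                        ≡⟨ ∣p∣≡∑∣p∩V∣ V partition T ⟩
    sum (λ i → ∣ T ∩ V i ∣)                                      ≤⟨ sum-mono-≤ ∣T∩V∣≤2χ ⟩
    sum (λ i → χ (Vec.lookup I i) + χ (Vec.lookup I i))          ≡⟨ ∑-distrib-+ (χ ∘ Vec.lookup I) (χ ∘ Vec.lookup I) ⟩
    sum (χ ∘ Vec.lookup I) + sum (χ ∘ Vec.lookup I)              ≡⟨ cong₂ _+_ (∣p∣≡∑χ I) (∣p∣≡∑χ I) ⟨
    ∣ I ∣ + ∣ I ∣                                                ≤⟨ 2∣I∣≤1+m independent ⟩
    suc m                                                        ∎
    where
    open ℕ.≤-Reasoning
    meets? : ∀ i → Dec (Nonempty (T ∩ V i))
    meets? i = nonempty? (T ∩ V i)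

    -- The indices of the parts that `T` meets; each accounts for at most two vertices of `T`.
    I : Subset m
    I = Vec.tabulate (does ∘ meets?)

    ∣T∩V∣≤2 : ∀ i → ∣ T ∩ V i ∣ ≤ℕ 2
    ∣T∩V∣≤2 i = ℕ.≮⇒≥ λ 3≤ →
      let e , e⊆ , ∣e∣≡3 = k≤∣p∣⇒∃q⊆p (T ∩ V i) 3≤
      in within-part⇒¬edge (p∩q⊆q T (V i) ∘ e⊆) (clique e (p∩q⊆p T (V i) ∘ e⊆) ∣e∣≡3)

    ∣T∩V∣≤2χ : ∀ i → ∣ T ∩ V i ∣ ≤ℕ χ (Vec.lookup I i) + χ (Vec.lookup I i)
    ∣T∩V∣≤2χ i rewrite lookup∘tabulate (does ∘ meets?) i with meets? i
    ... | yes _     = ∣T∩V∣≤2 i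
    ... | no  empty = ℕ.≤-reflexive (trans (cong ∣_∣ (Empty-unique empty)) (∣⊥∣≡0 n))

    representative : ∀ {i} → i ∈ I → ∃[ x ] x ∈ T × π x ≡ i
    -- For a part that `T` misses, the second equation would identify `outside` with `inside`, so
    -- only one case remains.
    representative {i} i∈I with meets? i | trans (sym (lookup∘tabulate (does ∘ meets?) i)) ([]=⇒lookup i∈I)
    ... | yes (x , x∈) | _ = let x∈T , x∈V = x∈p∩q⁻ T (V i) x∈ in x , x∈T , x∈V⇒π≡ x∈V

    -- An edge of `S` inside `I` lifts to three vertices of `T` in its three parts. The clique makes
    -- them an edge of `G`, yet triples over an edge of `S` are not edges.
    independent : IsIndependent S I
    independent {e} e⊆I Se
      with ∣e∣≡3 ← edge-size S Se
      with i , i∈e ← 1≤∣p∣⇒∃∈p {p = e} (subst (1 ≤ℕ_) (sym ∣e∣≡3) (s≤s z≤n))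
      with j , j∈e , i≢j , _ ← ∣p∣≡3⇒∃third {p = e} ∣e∣≡3 i i
      with k , k∈e , i≢k , j≢k ← ∣p∣≡3⇒∃third {p = e} ∣e∣≡3 i j
      with ijk≡e ← ∣p∣≡3⇒triple≡p {p = e} ∣e∣≡3 i≢j i≢k j≢k i∈e j∈e k∈e
      -- Matching on `refl` replaces `i`, `j`, `k` by the projections of `x`, `y`, `z`, so their
      -- distinctness says that the vertices lie in different parts.
      with x , x∈T , refl ← representative (e⊆I i∈e)
      with y , y∈T , refl ← representative (e⊆I j∈e)
      with z , z∈T , refl ← representative (e⊆I k∈e)
      = over-edge⇒¬edge i≢j i≢k j≢k (subst (Edge S) (sym ijk≡e) Se)
          (clique _ (triple⊆ x∈T y∈T z∈T) (∣triple∣≡3 (π≢⇒x≢ i≢j) (π≢⇒x≢ i≢k) (π≢⇒x≢ j≢k)))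

  -- Triples that are edges, and the codegree of each pair.

  module _ {x y z : Fin n} (x≢y : x ≢ y) (x≢z : x ≢ z) (y≢z : y ≢ z) where

    ∣triple∩V∣ : ∀ {i a b c} → ∣ ⁅ x ⁆ ∩ V i ∣ ≡ a → ∣ ⁅ y ⁆ ∩ V i ∣ ≡ b → ∣ ⁅ z ⁆ ∩ V i ∣ ≡ c →
                 ∣ triple x y z ∩ V i ∣ ≡ a + (b + c)
    ∣triple∩V∣ refl refl refl = ∣triple∩q∣ (V _) x≢y x≢z y≢z

    -- In these four lemmas the suffix shows the pattern of parts of `x`, `y`, `z`, with equal
    -- letters for equal parts. Intersections with a part are computed vertex by vertex.
    edge-xxz : π x ≡ π y → π x ≢ π z → Edge G (triple x y z)
    edge-xxz πx≡πy πx≢πz = ∣triple∣≡3 x≢y x≢z y≢z , inj₁ (π x , π z , πx≢πz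
      , ∣triple∩V∣ (∣⁅x⁆∩V∣≡1 x refl) (∣⁅x⁆∩V∣≡1 y (sym πx≡πy)) (∣⁅x⁆∩V∣≡0 z (≢-sym πx≢πz))
      , ∣triple∩V∣ (∣⁅x⁆∩V∣≡0 x πx≢πz) (∣⁅x⁆∩V∣≡0 y (πx≢πz ∘ trans πx≡πy)) (∣⁅x⁆∩V∣≡1 z refl))

    edge-xyx : π x ≢ π y → π z ≡ π x → Edge G (triple x y z)
    edge-xyx πx≢πy πz≡πx = ∣triple∣≡3 x≢y x≢z y≢z , inj₁ (π x , π y , πx≢πy
      , ∣triple∩V∣ (∣⁅x⁆∩V∣≡1 x refl) (∣⁅x⁆∩V∣≡0 y (≢-sym πx≢πy)) (∣⁅x⁆∩V∣≡1 z πz≡πx)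
      , ∣triple∩V∣ (∣⁅x⁆∩V∣≡0 x πx≢πy) (∣⁅x⁆∩V∣≡1 y refl) (∣⁅x⁆∩V∣≡0 z (πx≢πy ∘ trans (sym πz≡πx))))

    edge-xyy : π x ≢ π y → π z ≡ π y → Edge G (triple x y z)
    edge-xyy πx≢πy πz≡πy = ∣triple∣≡3 x≢y x≢z y≢z , inj₁ (π y , π x , ≢-sym πx≢πy
      , ∣triple∩V∣ (∣⁅x⁆∩V∣≡0 x πx≢πy) (∣⁅x⁆∩V∣≡1 y refl) (∣⁅x⁆∩V∣≡1 z πz≡πy)
      , ∣triple∩V∣ (∣⁅x⁆∩V∣≡1 x refl) (∣⁅x⁆∩V∣≡0 y (≢-sym πx≢πy)) (∣⁅x⁆∩V∣≡0 z λ πz≡πx → πx≢πy (trans (sym πz≡πx) πz≡πy)))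

    edge-xyz : π x ≢ π y → π x ≢ π z → π y ≢ π z → ¬ Edge S (triple (π x) (π y) (π z)) → Edge G (triple x y z)
    edge-xyz πx≢πy πx≢πz πy≢πz ¬Sπ = ∣triple∣≡3 x≢y x≢z y≢z , inj₂ (π x , π y , π z , (πx≢πy , πx≢πz , πy≢πz)
      , ( ∣triple∩V∣ (∣⁅x⁆∩V∣≡1 x refl) (∣⁅x⁆∩V∣≡0 y (≢-sym πx≢πy)) (∣⁅x⁆∩V∣≡0 z (≢-sym πx≢πz))
        , ∣triple∩V∣ (∣⁅x⁆∩V∣≡0 x πx≢πy) (∣⁅x⁆∩V∣≡1 y refl) (∣⁅x⁆∩V∣≡0 z (≢-sym πy≢πz))
        , ∣triple∩V∣ (∣⁅x⁆∩V∣≡0 x πx≢πz) (∣⁅x⁆∩V∣≡0 y πy≢πz) (∣⁅x⁆∩V∣≡1 z refl))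
      , ¬Sπ)

  -- The vertices other than `x` and `y` that fail to complete the pair to an edge are those of a
  -- single part, so `codegree-bounds` applies with that part as `p`.
  codegree≈n-∣V∣ : ∀ {x y} → x ≢ y → ∃[ k ] codegree G x y + ∣ V k ∣ ≤ℕ n × n ≤ℕ 2 + codegree G x y + ∣ V k ∣
  codegree≈n-∣V∣ {x} {y} x≢y with π x ≟ π y
  ... | yes πx≡πy = π x , codegree-bounds (V (π x))
    (λ _ _ Gxyz z∈V → within-part⇒¬edge (triple⊆ (x∈Vπ x) (subst (λ i → y ∈ V i) (sym πx≡πy) (x∈Vπ y)) z∈V) Gxyz)
    (λ {z} x≢z y≢z z∉V → edge-xxz x≢y x≢z y≢z πx≡πy λ πx≡πz → z∉V (subst (λ i → z ∈ V i) (sym πx≡πz) (x∈Vπ z)))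
    where open Codegree G x≢y
  ... | no πx≢πy with k , πx≢k , πy≢k , Sxyk ← third πx≢πy = k , codegree-bounds (V k)
    (λ _ _ Gxyz z∈V → case x∈V⇒π≡ z∈V of λ { refl → over-edge⇒¬edge πx≢πy πx≢k πy≢k Sxyk Gxyz })
    covers
    where
    open Codegree G x≢y
    covers : ∀ {z} → x ≢ z → y ≢ z → z ∉ V k → Edge G (triple x y z)
    covers {z} x≢z y≢z z∉V with π z ≟ π x | π z ≟ π y
    ... | yes πz≡πx | _         = edge-xyx x≢y x≢z y≢z πx≢πy πz≡πx
    ... | no  _     | yes πz≡πy = edge-xyy x≢y x≢z y≢z πx≢πy πz≡πy
    -- If the three projections formed an edge of `S`, uniqueness of the third point would put `z`
    -- in `V k`.
    ... | no  πz≢πx | no  πz≢πy = edge-xyz x≢y x≢z y≢z πx≢πy (≢-sym πz≢πx) (≢-sym πz≢πy) λ Sπ →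
      z∉V (subst (λ i → z ∈ V i) (third-unique πx≢πy (≢-sym πz≢πx) (≢-sym πz≢πy) Sxyk Sπ) (x∈Vπ z))

  -- Part sizes, and codegree estimates scaled by `m`.

  n≡∑∣V∣ : n ≡ sum (∣_∣ ∘ V)
  n≡∑∣V∣ = begin
    n                          ≡⟨ ∣⊤∣≡n n ⟨
    ∣ ⊤ {n} ∣                  ≡⟨ ∣p∣≡∑∣p∩V∣ V partition ⊤ ⟩
    sum (λ i → ∣ ⊤ ∩ V i ∣)    ≡⟨ sum-cong-≗ (λ i → cong ∣_∣ (∩-identityˡ (V i))) ⟩
    sum (∣_∣ ∘ V)              ∎
    where open ≡-Reasoning

  -- Balance bounds every part by one more than the `k`-th, and the `m` parts add up to `n`.
  -- Multiplying by `m` avoids dividing `n`.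
  n≤m∣V∣+m : ∀ k → n ≤ℕ m * ∣ V k ∣ + m
  n≤m∣V∣+m k = begin
    n                         ≡⟨ n≡∑∣V∣ ⟩
    sum (∣_∣ ∘ V)             ≤⟨ sum-mono-≤ (λ i → balanced i k) ⟩
    sum {m} (λ _ → suc ∣ V k ∣) ≡⟨ sum-const m (suc ∣ V k ∣) ⟩
    m * suc ∣ V k ∣           ≡⟨ ℕ.*-suc m ∣ V k ∣ ⟩
    m + m * ∣ V k ∣           ≡⟨ ℕ.+-comm m _ ⟩
    m * ∣ V k ∣ + m           ∎
    where open ℕ.≤-Reasoning

  m∣V∣≤n+m : ∀ k → m * ∣ V k ∣ ≤ℕ n + m
  m∣V∣≤n+m k = begin
    m * ∣ V k ∣                       ≡⟨ sum-const m ∣ V k ∣ ⟨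
    sum {m} (λ _ → ∣ V k ∣)           ≤⟨ sum-mono-≤ (λ i → balanced k i) ⟩
    sum (λ i → 1 + ∣ V i ∣)           ≡⟨ ∑-distrib-+ (λ _ → 1) (∣_∣ ∘ V) ⟩
    sum {m} (λ _ → 1) + sum (∣_∣ ∘ V) ≡⟨ cong₂ _+_ (sum-const m 1) (sym n≡∑∣V∣) ⟩
    m * 1 + n                         ≡⟨ cong (_+ n) (ℕ.*-identityʳ m) ⟩
    m + n                             ≡⟨ ℕ.+-comm m n ⟩
    n + m                             ∎
    where open ℕ.≤-Reasoning

  -- In the lower bound `2 * m` of the error comes from the two vertices of the pair and `m` from
  -- the imbalance of the parts. The upper bound has error `m`, relaxed to the same `3 * m`.
  m*codegree-bounds : ∀ {x y} → x ≢ y →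
    m * n ≤ℕ m * codegree G x y + n + 3 * m × m * codegree G x y + n ≤ℕ m * n + 3 * m
  m*codegree-bounds {x} {y} x≢y = lower , upper
    where
    open ℕ.≤-Reasoning
    c = codegree G x y
    k = proj₁ (codegree≈n-∣V∣ x≢y)
    v = ∣ V k ∣
    c+v≤n = proj₁ (proj₂ (codegree≈n-∣V∣ x≢y))
    n≤2+c+v = proj₂ (proj₂ (codegree≈n-∣V∣ x≢y))

    lower : m * n ≤ℕ m * c + n + 3 * m
    lower = begin
      m * n                        ≤⟨ ℕ.*-monoʳ-≤ m n≤2+c+v ⟩
      m * (2 + c + v)              ≡⟨ solve 3 (λ m c v → m :* (con 2 :+ c :+ v) := m :* c :+ con 2 :* m :+ m :* v) refl m c v ⟩
      m * c + 2 * m + m * v        ≤⟨ ℕ.+-monoʳ-≤ (m * c + 2 * m) (m∣V∣≤n+m k) ⟩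
      m * c + 2 * m + (n + m)      ≡⟨ solve 3 (λ m c n → m :* c :+ con 2 :* m :+ (n :+ m) := m :* c :+ n :+ con 3 :* m) refl m c n ⟩
      m * c + n + 3 * m            ∎

    upper : m * c + n ≤ℕ m * n + 3 * m
    upper = begin
      m * c + n                    ≤⟨ ℕ.+-monoʳ-≤ (m * c) (n≤m∣V∣+m k) ⟩
      m * c + (m * v + m)          ≡⟨ solve 3 (λ m c v → m :* c :+ (m :* v :+ m) := m :* (c :+ v) :+ m) refl m c v ⟩
      m * (c + v) + m              ≤⟨ ℕ.+-mono-≤ (ℕ.*-monoʳ-≤ m c+v≤n) (ℕ.m≤n*m m 3) ⟩
      m * n + 3 * m                ∎

  -- The minimum codegree.

  δ₂≤codegree : ∀ {x y} → x ≢ y → δ₂ G ≤ℕ codegree G x y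
  δ₂≤codegree {x} {y} x≢y = All.lookup (min≤xs n (map (uncurry (codegree G)) (distinctPairs n)))
    (∈-map⁺ (uncurry (codegree G))
      (∈-filter⁺ (uncurry λ x y → ¬? (x ≟ y)) (∈-cartesianProduct⁺ (∈-allFin x) (∈-allFin y)) x≢y))

  -- `min` returns either one of the listed codegrees or its default `n`, so the default is a case
  -- of its own.
  δ₂-attained : δ₂ G ≡ n ⊎ ∃₂ λ x y → x ≢ y × δ₂ G ≡ codegree G x y
  δ₂-attained with argmin-sel id n (map (uncurry (codegree G)) (distinctPairs n))
  ... | inj₁ δ₂≡n = inj₁ δ₂≡n
  ... | inj₂ δ₂∈ with (x , y) , xy∈ , δ₂≡ ← ∈-map⁻ (uncurry (codegree G)) δ₂∈
    = inj₂ (x , y , proj₂ (∈-filter⁻ (uncurry λ x y → ¬? (x ≟ y)) {xs = cartesianProduct (allFin n) (allFin n)} xy∈) , δ₂≡)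

  mn≤mδ₂+n+3m : m * n ≤ℕ m * δ₂ G + n + 3 * m
  mn≤mδ₂+n+3m with δ₂-attained
  ... | inj₁ δ₂≡n =
    subst (λ δ → m * n ≤ℕ m * δ + n + 3 * m) (sym δ₂≡n) (ℕ.≤-trans (ℕ.m≤m+n (m * n) n) (ℕ.m≤m+n _ (3 * m)))
  ... | inj₂ (_ , _ , x≢y , δ₂≡c) =
    subst (λ δ → m * n ≤ℕ m * δ + n + 3 * m) (sym δ₂≡c) (proj₁ (m*codegree-bounds x≢y))

  δ₂≤n : δ₂ G ≤ℕ n
  δ₂≤n = min≤⊤ n (map (uncurry (codegree G)) (distinctPairs n))

  mδ₂+n≤mn+3m : 1 ≤ℕ m → m * δ₂ G + n ≤ℕ m * n + 3 * m
  mδ₂+n≤mn+3m 1≤m with distinct-or-small n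
  ... | inj₁ (x , y , x≢y) = begin
    m * δ₂ G + n              ≤⟨ ℕ.+-monoˡ-≤ n (ℕ.*-monoʳ-≤ m (δ₂≤codegree x≢y)) ⟩
    m * codegree G x y + n    ≤⟨ proj₂ (m*codegree-bounds x≢y) ⟩
    m * n + 3 * m             ∎
    where open ℕ.≤-Reasoning
  -- Without a pair of vertices, `δ₂≤n` handles the product, and the extra `n` is at most 1, hence
  -- at most `3 * m`.
  ... | inj₂ n≤1 = ℕ.+-mono-≤ {m * δ₂ G} {m * n} (ℕ.*-monoʳ-≤ m δ₂≤n) (ℕ.≤-trans n≤1 (ℕ.≤-trans 1≤m (ℕ.m≤n*m m 3)))

-- From scaled natural-number bounds to a rational estimate.

∣m-n∣≤o : ∀ {m n o} → m ≤ℕ n + o → n ≤ℕ m + o → ℤ.∣ ℤ.+ m ℤ.- ℤ.+ n ∣ ≤ℕ o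
∣m-n∣≤o {m} {n} {o} m≤n+o n≤m+o rewrite ℤ.[+m]-[+n]≡m⊖n m n with ℕ.≤-total m n
... | inj₁ m≤n rewrite ℤ.∣⊖∣-≤ m≤n = ℕ.m≤n+o⇒m∸n≤o n m n≤m+o
... | inj₂ n≤m rewrite ℤ.∣m⊖n∣≡∣n⊖m∣ m n | ℤ.∣⊖∣-≤ n≤m = ℕ.m≤n+o⇒m∸n≤o m n m≤n+o

-- Multiplied by `m`, the claim bounds the distance between `m * δ` and `(m ∸ 1) * n` by `3 * m`,
-- which is what the two hypotheses say once `n` is cancelled. The computation uses unnormalised
-- rationals, whose numerators and denominators are explicit. In the clause below `m` is the
-- predecessor.
∣δ-[1-1/m]n∣≤3 : ∀ m .{{_ : NonZero m}} δ n →
  m * n ≤ℕ m * δ + n + 3 * m → m * δ + n ≤ℕ m * n + 3 * m →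
  ℚ.∣ (ℤ.+ δ) ℚ./ 1 ℚ.- (ℚ.1ℚ ℚ.- (ℤ.+ 1) ℚ./ m) ℚ.* ((ℤ.+ n) ℚ./ 1) ∣ ℚ.≤ (ℤ.+ 3) ℚ./ 1
∣δ-[1-1/m]n∣≤3 (suc m) δ n lower upper = ℚ.toℚᵘ-cancel-≤ (ℚᵘ.≤-respˡ-≃ (ℚᵘ.≃-sym toℚᵘ-lhs) (ℚᵘ.*≤* numerators))
  where
  a r b t : ℚ
  a = (ℤ.+ δ) ℚ./ 1
  r = (ℤ.+ 1) ℚ./ suc m
  b = (ℤ.+ n) ℚ./ 1
  t = (ℚ.1ℚ ℚ.- r) ℚ.* b

  aᵘ rᵘ bᵘ tᵘ lhsᵘ : ℚᵘ
  aᵘ = mkℚᵘ (ℤ.+ δ) 0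
  rᵘ = mkℚᵘ (ℤ.+ 1) m
  bᵘ = mkℚᵘ (ℤ.+ n) 0
  tᵘ = (ℚᵘ.1ℚᵘ ℚᵘ.- rᵘ) ℚᵘ.* bᵘ
  lhsᵘ = ℚᵘ.∣ aᵘ ℚᵘ.- tᵘ ∣

  toℚᵘ-homo-- : ∀ p q {pᵘ qᵘ} → ℚ.toℚᵘ p ℚᵘ.≃ pᵘ → ℚ.toℚᵘ q ℚᵘ.≃ qᵘ → ℚ.toℚᵘ (p ℚ.- q) ℚᵘ.≃ pᵘ ℚᵘ.- qᵘ
  toℚᵘ-homo-- p q p≃ q≃ = ℚᵘ.≃-trans (ℚ.toℚᵘ-homo-+ p (ℚ.- q))
    (ℚᵘ.+-cong p≃ (ℚᵘ.≃-trans (ℚ.toℚᵘ-homo‿- q) (ℚᵘ.-‿cong q≃)))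

  toℚᵘ-lhs : ℚ.toℚᵘ ℚ.∣ a ℚ.- t ∣ ℚᵘ.≃ lhsᵘ
  toℚᵘ-lhs = ℚᵘ.≃-trans (ℚ.toℚᵘ-homo-∣-∣ (a ℚ.- t)) (ℚᵘ.∣-∣-cong
    (toℚᵘ-homo-- a t (ℚ.toℚᵘ-fromℚᵘ aᵘ)
      (ℚᵘ.≃-trans (ℚ.toℚᵘ-homo-* (ℚ.1ℚ ℚ.- r) b)
        (ℚᵘ.*-cong (toℚᵘ-homo-- ℚ.1ℚ r ℚᵘ.≃-refl (ℚ.toℚᵘ-fromℚᵘ rᵘ)) (ℚ.toℚᵘ-fromℚᵘ bᵘ)))))

  numerators : ℚᵘ.↥ lhsᵘ ℤ.* ℤ.+ 1 ℤ.≤ ℤ.+ 3 ℤ.* ℚᵘ.↧ lhsᵘ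
  numerators = subst₂ (λ p q → ℤ.+ ℤ.∣ p ∣ ℤ.* ℤ.+ 1 ℤ.≤ ℤ.+ 3 ℤ.* q) (sym num≡) (sym den≡)
    (subst₂ ℤ._≤_ (sym (ℤ.*-identityʳ _)) (ℤ.pos-* 3 (suc m)) (ℤ.+≤+ bound))
    where
    den₁≡ : ℚᵘ.↧ tᵘ ≡ ℤ.+ suc m
    den₁≡ = cong (ℤ.+_ ∘ suc) (trans (ℕ.*-identityʳ (m + 0)) (ℕ.+-identityʳ m))

    den≡ : ℚᵘ.↧ lhsᵘ ≡ ℤ.+ suc m
    den≡ = trans (ℤ.*-identityˡ (ℚᵘ.↧ tᵘ)) den₁≡

    num≡ : ℚᵘ.↥ (aᵘ ℚᵘ.- tᵘ) ≡ ℤ.+ (suc m * δ) ℤ.- ℤ.+ (m * n)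
    num≡ = begin
      ℤ.+ δ ℤ.* ℚᵘ.↧ tᵘ ℤ.+ ℚᵘ.↥ (ℚᵘ.- tᵘ) ℤ.* ℤ.+ 1
        ≡⟨ cong (λ d → ℤ.+ δ ℤ.* d ℤ.+ ℚᵘ.↥ (ℚᵘ.- tᵘ) ℤ.* ℤ.+ 1) den₁≡ ⟩
      ℤ.+ δ ℤ.* ℤ.+ suc m ℤ.+ ℚᵘ.↥ (ℚᵘ.- tᵘ) ℤ.* ℤ.+ 1
        ≡⟨ ℤS.solve 3 (λ δ m n →
             δ ℤS.:* (ℤS.con ℤ.1ℤ ℤS.:+ m)
               ℤS.:+ (ℤS.:- ((ℤS.con ℤ.1ℤ ℤS.:* (ℤS.con ℤ.1ℤ ℤS.:+ m) ℤS.:+ ℤS.con ℤ.-1ℤ ℤS.:* ℤS.con ℤ.1ℤ) ℤS.:* n)) ℤS.:* ℤS.con ℤ.1ℤ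
             ℤS.:= (ℤS.con ℤ.1ℤ ℤS.:+ m) ℤS.:* δ ℤS.:- m ℤS.:* n) refl (ℤ.+ δ) (ℤ.+ m) (ℤ.+ n) ⟩
      ℤ.+ suc m ℤ.* ℤ.+ δ ℤ.- ℤ.+ m ℤ.* ℤ.+ n
        ≡⟨ cong₂ ℤ._-_ (ℤ.pos-* (suc m) δ) (ℤ.pos-* m n) ⟨
      ℤ.+ (suc m * δ) ℤ.- ℤ.+ (m * n)  ∎
      where open ≡-Reasoning

    bound : ℤ.∣ ℤ.+ (suc m * δ) ℤ.- ℤ.+ (m * n) ∣ ≤ℕ 3 * suc m
    -- `suc m * n` unfolds to `n + m * n`, so both hypotheses have a summand `n` to cancel.
    bound = ∣m-n∣≤o {suc m * δ} {m * n}
      (ℕ.+-cancelˡ-≤ n _ _ (subst₂ _≤ℕ_ (ℕ.+-comm (suc m * δ) n) (ℕ.+-assoc n (m * n) (3 * suc m)) upper))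
      (ℕ.+-cancelˡ-≤ n _ _ (ℕ.≤-trans lower (ℕ.≤-reflexive
        (trans (cong (_+ 3 * suc m) (ℕ.+-comm (suc m * δ) n)) (ℕ.+-assoc n (suc m * δ) (3 * suc m))))))

proposition7 : ∀ (s : ℕ) (5≤s : 5 ≤ℕ s) → s % 6 ≡ 3 ⊎ s % 6 ≡ 5 →
    (∀ (S : 3-Graph (s ∸ 2)) → IsSteinerTripleSystem S →
    ∀ (n : ℕ) (P : BalancedPartition (s ∸ 2) n) →
    K[ s ]-Free G[ S , P ])
    ×
    (∃[ C ] ∀ (S : 3-Graph (s ∸ 2)) → IsSteinerTripleSystem S →
    ∀ (n : ℕ) (P : BalancedPartition (s ∸ 2) n) →
    ℚ.∣ (ℤ.+ δ₂ G[ S , P ]) ℚ./ 1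
    ℚ.- (ℚ.1ℚ ℚ.- ℚ._/_ (ℤ.+ 1) (s ∸ 2) {{s∸2-nonZero 5≤s}}) ℚ.* ((ℤ.+ n) ℚ./ 1) ∣
    ℚ.≤ C)
-- The constant 3 is the scaled error `3 * m` divided by `m`, the same for all `S`, `n` and `P`.
proposition7 s 5≤s _ = K-free , (ℤ.+ 3) ℚ./ 1 , codegree-estimate
  where
  instance
    m≢0 : NonZero (s ∸ 2)
    m≢0 = s∸2-nonZero 5≤s

  K-free : (S : 3-Graph (s ∸ 2)) → IsSteinerTripleSystem S →
           ∀ n (P : BalancedPartition (s ∸ 2) n) → K[ s ]-Free G[ S , P ]
  K-free S steiner n P (T , ∣T∣≡s , clique) = ℕ.1+n≰n (begin
    1 + s            ≡⟨ cong suc ∣T∣≡s ⟨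
    1 + ∣ T ∣        ≤⟨ s≤s (BlowUp.clique-size S steiner P clique) ⟩
    2 + (s ∸ 2)      ≡⟨ ℕ.m+[n∸m]≡n (ℕ.≤-trans (s≤s (s≤s z≤n)) 5≤s) ⟩
    s                ∎)
    where open ℕ.≤-Reasoning

  codegree-estimate : (S : 3-Graph (s ∸ 2)) → IsSteinerTripleSystem S →
    ∀ n (P : BalancedPartition (s ∸ 2) n) →
    ℚ.∣ (ℤ.+ δ₂ G[ S , P ]) ℚ./ 1 ℚ.- (ℚ.1ℚ ℚ.- (ℤ.+ 1) ℚ./ (s ∸ 2)) ℚ.* ((ℤ.+ n) ℚ./ 1) ∣ ℚ.≤ (ℤ.+ 3) ℚ./ 1
  codegree-estimate S steiner n P = ∣δ-[1-1/m]n∣≤3 (s ∸ 2) (δ₂ G[ S , P ]) n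
    (BlowUp.mn≤mδ₂+n+3m S steiner P) (BlowUp.mδ₂+n≤mn+3m S steiner P (>-nonZero⁻¹ (s ∸ 2)))
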